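{- Let $n\ge 3$ and consider the cycle $C_n$ with an arbitrary initial coloring. In the Majority Model (MM): if $n$ is odd, the process always reaches a stable coloring; if $n$ is even, the process reaches a stable coloring or the blinking configuration. In the Random Majority Model (RMM): if $n$ is odd, the process (almost surely) reaches the all-white or the all-blue coloring; if $n$ is even, the process reaches the all-white coloring, the all-blue coloring, or the blinking configuration.
   Context: A coloring is a map from the nodes to $\{b,w\}$. In MM, all nodes update simultaneously: a node adopts the color strictly more frequent among its neighbors in the previous round and keeps its color in case of a tie. RMM is the same except that in case of a tie the node chooses blue or white independently and uniformly at random. A coloring is stable if one application of the update rule deterministically returns the same coloring. For even $n$, the two alternating colorings are those in which every two adjacent nodes of $C_n$ have different colors; the process is in the blinking configuration when it is in one of them (it then switches between the two forever). -}

module Defs where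

open import Algebra.Definitions.RawSemiring using (sum; _^_)
open import Data.Bool using (if_then_else_)
open import Data.Fin using (Fin; toℕ)
open import Data.List using (List; allFin; filter; length)
open import Data.Maybe using (Maybe; just; nothing)
open import Data.Nat using (ℕ; zero; suc; _*_; _≤_; _<ᵇ_; s≤s; _≟_)
open import Data.Product using (Σ; ∃; _×_; _,_)
open import Data.Empty using (⊥)
open import Data.Rational as ℚ using (ℚ; 0ℚ; ½; +-*-rawSemiring)
open import Data.Sum using (_⊎_; inj₁; inj₂; swap)
open import Relation.Binary.Definitions using (Decidable; DecidableEquality; Irreflexive; Symmetric)
open import Relation.Binary.PropositionalEquality using (_≡_; _≢_; _≗_; refl)
open import Relation.Nullary using (¬_; yes; no)
open import Relation.Nullary.Decidable using (_⊎-dec_; _×-dec_)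

record Graph (n : ℕ) : Set₁ where
  field
    Adj    : Fin n → Fin n → Set
    adj?   : Decidable Adj
    symm   : Symmetric Adj
    irrefl : Irreflexive _≡_ Adj

  neighbours : Fin n → List (Fin n)
  neighbours i = filter (adj? i) (allFin n)

open Graph public using (Adj; neighbours)

-- j is the cyclic successor of i, i.e. j = i + 1 modulo n.
Next : ∀ {n} → Fin n → Fin n → Set
Next {n} i j = (suc (toℕ i) ≡ toℕ j) ⊎ ((suc (toℕ i) ≡ n) × (toℕ j ≡ 0))

next? : ∀ {n} → Decidable (Next {n})
next? {n} i j = (suc (toℕ i) ≟ toℕ j) ⊎-dec ((suc (toℕ i) ≟ n) ×-dec (toℕ j ≟ 0))

next-irrefl : ∀ {n} → 3 ≤ n → (i : Fin n) → ¬ Next i i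
next-irrefl _ i (inj₁ e) = lemma e
  where
  lemma : ∀ {m} → suc m ≢ m
  lemma ()
next-irrefl 3≤n i (inj₂ (e , z)) with toℕ i | e | z
next-irrefl (s≤s ()) i (inj₂ _) | zero | refl | refl

cycle : (n : ℕ) → 3 ≤ n → Graph n
cycle n 3≤n = record
  { Adj    = λ i j → Next i j ⊎ Next j i
  ; adj?   = λ i j → next? i j ⊎-dec next? j i
  ; symm   = swap
  ; irrefl = λ { {i} refl (inj₁ p) → next-irrefl 3≤n i p
               ; {i} refl (inj₂ p) → next-irrefl 3≤n i p }
  }

data Color : Set where
  blue white : Color

_≟ᶜ_ : DecidableEquality Color
blue  ≟ᶜ blue  = yes refl
blue  ≟ᶜ white = no λ ()
white ≟ᶜ blue  = no λ ()
white ≟ᶜ white = yes refl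

Coloring : ℕ → Set
Coloring n = Fin n → Color

count : ∀ {n} → Graph n → Coloring n → Color → Fin n → ℕ
count G c k i = length (filter (λ j → c j ≟ᶜ k) (neighbours G i))

-- One synchronous round; node i takes the color "tie i" when neither color is
-- strictly more frequent among its neighbours.
update : ∀ {n} → Graph n → (tie : Coloring n) → Coloring n → Coloring n
update G tie c i =
  if count G c white i <ᵇ count G c blue i then blue
  else if count G c blue i <ᵇ count G c white i then white
  else tie i

mmStep : ∀ {n} → Graph n → Coloring n → Coloring n
mmStep G c = update G c c

MM : ∀ {n} → Graph n → Coloring n → ℕ → Coloring n
MM G c₀ zero    = c₀
MM G c₀ (suc t) = mmStep G (MM G c₀ t)

MMStable : ∀ {n} → Graph n → Coloring n → Set
MMStable G c = mmStep G c ≗ c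

Alternating : ∀ {n} → Graph n → Coloring n → Set
Alternating G c = ∀ i j → Adj G i j → c i ≢ c j

AllBlue AllWhite : ∀ {n} → Coloring n → Set
AllBlue  c = ∀ i → c i ≡ blue
AllWhite c = ∀ i → c i ≡ white

-- Sample space of the random model: ω t i is the fair coin of node i for the
-- round from time t to time t + 1, consulted only in case of a tie.
Ω : ℕ → Set
Ω n = ℕ → Fin n → Color

RMM : ∀ {n} → Graph n → Coloring n → Ω n → ℕ → Coloring n
RMM G c₀ ω zero    = c₀
RMM G c₀ ω (suc t) = update G (ω t) (RMM G c₀ ω t)

-- (k , p) stands for the set of all ω whose first k rounds of coins are p.
Cylinder : ℕ → Set
Cylinder n = Σ ℕ λ k → Fin k → Fin n → Color

-- "nothing" is the empty set, so that finite covers are countable covers.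
_∈ᶜ_ : ∀ {n} → Ω n → Maybe (Cylinder n) → Set
ω ∈ᶜ nothing      = ⊥
ω ∈ᶜ just (k , p) = ∀ s i → ω (toℕ s) i ≡ p s i

-- The product measure making all coins independent and uniform: fixing the
-- coins of k rounds fixes k * n of them.
μ : ∀ {n} → Maybe (Cylinder n) → ℚ
μ     nothing        = 0ℚ
μ {n} (just (k , _)) = _^_ +-*-rawSemiring ½ (k * n)

-- Outer measure zero: for every ε > 0 there is a countable cover by cylinders
-- of total measure at most ε (all partial sums are at most ε).
Null : ∀ {n} → (Ω n → Set) → Set
Null {n} A = (ε : ℚ) → 0ℚ ℚ.< ε → Σ (ℕ → Maybe (Cylinder n)) λ C →
  (∀ ω → A ω → ∃ λ m → ω ∈ᶜ C m) ×
  (∀ m → sum +-*-rawSemiring {m} (λ l → μ (C (toℕ l))) ℚ.≤ ε)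

AlmostSurely : ∀ {n} → (Ω n → Set) → Set
AlmostSurely P = Null (λ ω → ¬ P ω)

Reaches : ∀ {n} → (ℕ → Coloring n) → (Coloring n → Set) → Set
Reaches X P = ∃ λ t → P (X t)

{-# OPTIONS --safe #-}

-- On a cycle the new color of a node is the common color of its two neighbours, or the tie color.
--
-- MM: a node with a neighbour of its own color is locked forever, and a locked node locks its
-- successor within one round. So one monochromatic edge ends in a stable coloring; without such an
-- edge the coloring alternates, which is impossible for odd n.
--
-- RMM: almost surely some block of n consecutive rounds has only white coins. When ties are broken
-- to white, a node is blue iff both its neighbours were, so after n such rounds node k + n is blue
-- iff k, k + 2, …, k + 2 n all were. This set is the whole orbit of k under the shift by 2, hence the
-- coloring is invariant under that shift: it is constant or alternating. No block being white in t
-- blocks is covered by (N − 1)^t cylinders of measure N^(−t), where N = 2^(n²).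

module Submission where

open import Defs
open import Algebra.Bundles using (module CommutativeRing)
import Algebra.Definitions.RawSemiring as RawSemiring
import Algebra.Properties.Semiring.Mult as SemiringMult
open import Data.Empty using (⊥)
open import Data.Fin using (Fin; zero; suc; toℕ; fromℕ<; splitAt)
open import Data.Fin.Properties using (toℕ-injective; toℕ<n; toℕ-fromℕ<; toℕ-↑ˡ; toℕ-↑ʳ; join-splitAt; any?)
open import Data.Integer as ℤ using (+_; +[1+_]; -[1+_])
import Data.Integer.Solver as ℤ
open import Data.List using (List; []; _∷_; _++_; map; length; allFin; cartesianProductWith)
open import Data.List.Membership.Propositional using (_∈_)
open import Data.List.Membership.Propositional.Properties using (∈-filter⁺; ∈-filter⁻; ∈-allFin)
open import Data.List.Membership.Propositional.Properties.WithK using (unique∧set⇒bag)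
open import Data.List.Properties using (length-++; length-map)
open import Data.List.Relation.Binary.BagAndSetEquality using (∼bag⇒↭)
open import Data.List.Relation.Binary.Permutation.Propositional using (_↭_)
open import Data.List.Relation.Binary.Permutation.Propositional.Properties using (filter-↭; ↭-length)
open import Data.List.Relation.Unary.All using ([]; _∷_)
open import Data.List.Relation.Unary.AllPairs using ([]; _∷_)
open import Data.List.Relation.Unary.Any as Any using (Any; here; there)
open import Data.List.Relation.Unary.Any.Properties using (++⁺ˡ; ++⁺ʳ; map⁺; cartesianProductWith⁺)
open import Data.List.Relation.Unary.Unique.Propositional.Properties using (allFin⁺; filter⁺)
open import Data.Maybe as Maybe using (Maybe; just; nothing)
open import Data.Nat using (ℕ; zero; suc; pred; _+_; _*_; _^_; _/_; _%_; _≤_; _<_; z≤n; s≤s; NonZero; >-nonZero)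
open import Data.Nat.Divisibility using (_∣_; _∤_; m%n≡0⇒n∣m; ∣-refl; m∣m*n)
open import Data.Nat.DivMod using (_mod_; m%n<n; m<n⇒m%n≡m; %-distribˡ-+; n%n≡0; m≡m%n+[m/n]*n; %-remove-+ˡ)
open import Data.Nat.Properties
open import Data.Nat.Tactic.RingSolver using (solve-∀)
open import Data.Product using (Σ; ∃; _×_; _,_; proj₁; proj₂; map₂)
open import Data.Rational as ℚ using (ℚ; 0ℚ; 1ℚ; ½; mkℚ; toℚᵘ)
import Data.Rational.Properties as ℚ
open import Data.Rational.Unnormalised as ℚᵘ using (mkℚᵘ; *≡*; *≤*)
import Data.Rational.Unnormalised.Properties as ℚᵘ
open import Data.Sum using (_⊎_; inj₁; inj₂; [_,_]′)
import Data.Vec.Functional as Vector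
open import Function using (_∘_; const; mk⇔)
open import Level using (0ℓ)
open import Relation.Binary.Core using (Rel)
open import Relation.Binary.PropositionalEquality
open import Relation.Nullary using (¬_; yes; no; contradiction)

open RawSemiring ℚ.+-*-rawSemiring using (sum) renaming (_^_ to _^ℚ_)
open SemiringMult (CommutativeRing.semiring ℚ.+-*-commutativeRing)
  renaming (_×_ to _·_)

-- Estimates: multiples and powers of one half, exponential growth.

·-nonNeg : ∀ m {q} → 0ℚ ℚ.≤ q → 0ℚ ℚ.≤ m · q
·-nonNeg zero    0≤q = ℚ.≤-refl
·-nonNeg (suc m) 0≤q = ℚ.+-mono-≤ 0≤q (·-nonNeg m 0≤q)

·-monoˡ-≤ : ∀ {m n q} → 0ℚ ℚ.≤ q → m ≤ n → m · q ℚ.≤ n · q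
·-monoˡ-≤ {n = n} 0≤q z≤n       = ·-nonNeg n 0≤q
·-monoˡ-≤ {q = q} 0≤q (s≤s m≤n) = ℚ.+-monoʳ-≤ q (·-monoˡ-≤ 0≤q m≤n)

-- Unnormalised, the multiple keeps the denominator of `q`, so `archimedean` becomes an inequality
-- between naturals.
toℚᵘ-· : ∀ m (q : ℚ) → toℚᵘ (m · q) ℚᵘ.≃ mkℚᵘ (+ m ℤ.* ℚ.↥ q) (ℚ.denominator-1 q)
toℚᵘ-· zero    q = *≡* refl
toℚᵘ-· (suc m) q@record{} = begin
  toℚᵘ (q ℚ.+ m · q)          ≈⟨ ℚ.toℚᵘ-homo-+ q (m · q) ⟩
  toℚᵘ q ℚᵘ.+ toℚᵘ (m · q)    ≈⟨ ℚᵘ.+-congʳ (toℚᵘ q) (toℚᵘ-· m q) ⟩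
  toℚᵘ q ℚᵘ.+ mkℚᵘ (+ m ℤ.* ℚ.↥ q) (ℚ.denominator-1 q)
    ≈⟨ *≡* (identity (ℚ.↥ q) (ℚ.↧ q) (+ m)) ⟩
  mkℚᵘ (+ suc m ℤ.* ℚ.↥ q) (ℚ.denominator-1 q) ∎
  where
  open ℚᵘ.≃-Reasoning
  open ℤ.+-*-Solver
  identity : ∀ a d m → (a ℤ.* d ℤ.+ (m ℤ.* a) ℤ.* d) ℤ.* d ≡ ((+ 1 ℤ.+ m) ℤ.* a) ℤ.* (d ℤ.* d)
  identity = solve 3 (λ a d m → (a :* d :+ (m :* a) :* d) :* d := ((con (+ 1) :+ m) :* a) :* (d :* d)) refl

-- The witness is the denominator of `ε`: a positive numerator is at least 1.
archimedean : ∀ ε → 0ℚ ℚ.< ε → ∃ λ m → 1ℚ ℚ.≤ m · ε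
archimedean ε@(mkℚ +[1+ a ] d _) _ = suc d , ℚ.toℚᵘ-cancel-≤ (R.begin
  ℚᵘ.1ℚᵘ                             R.≤⟨ *≤* (ℤ.+≤+ le) ⟩
  mkℚᵘ (+ suc d ℤ.* +[1+ a ]) d      R.≃⟨ toℚᵘ-· (suc d) ε ⟨
  toℚᵘ (suc d · ε)                   R.∎)
  where
  module R = ℚᵘ.≤-Reasoning
  le : 1 * suc d ≤ suc d * suc a * 1
  le = begin
    1 * suc d           ≡⟨ *-comm 1 (suc d) ⟩
    suc d * 1           ≤⟨ *-monoʳ-≤ (suc d) (s≤s z≤n) ⟩
    suc d * suc a       ≡⟨ *-identityʳ (suc d * suc a) ⟨
    suc d * suc a * 1   ∎
    where open ≤-Reasoning
archimedean (mkℚ (+ 0) _ _) (ℚ.*<* (ℤ.+<+ ()))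
archimedean (mkℚ -[1+ _ ] _ _) (ℚ.*<* ())

0≤½^ : ∀ k → 0ℚ ℚ.≤ ½ ^ℚ k
0≤½^ zero    = ℚ.nonNegative⁻¹ 1ℚ
0≤½^ (suc k) = subst (ℚ._≤ ½ ℚ.* ½ ^ℚ k) (ℚ.*-zeroʳ ½) (ℚ.*-monoˡ-≤-nonNeg ½ (0≤½^ k))

2^k·½^k≡1 : ∀ k → (2 ^ k) · (½ ^ℚ k) ≡ 1ℚ
2^k·½^k≡1 zero    = refl
2^k·½^k≡1 (suc k) = begin
  (2 * 2 ^ k) · (½ ℚ.* ½ ^ℚ k)   ≡⟨ ×-assocˡ _ 2 (2 ^ k) ⟨
  2 · ((2 ^ k) · (½ ℚ.* ½ ^ℚ k))   ≡⟨ cong (2 ·_) (×-comm-* (2 ^ k) ½ (½ ^ℚ k)) ⟨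
  2 · (½ ℚ.* ((2 ^ k) · (½ ^ℚ k)))   ≡⟨ cong (λ q → 2 · (½ ℚ.* q)) (2^k·½^k≡1 k) ⟩
  2 · (½ ℚ.* 1ℚ)                 ≡⟨⟩
  1ℚ                             ∎
  where open ≡-Reasoning

-- Multiplying by `m · ε`, which is at least 1, and moving `m` onto `a` reduces a bound by `ε` to
-- one between naturals.
·½^-≤ : ∀ a m k {ε} → 0ℚ ℚ.< ε → 1ℚ ℚ.≤ m · ε → m * a ≤ 2 ^ k → a · (½ ^ℚ k) ℚ.≤ ε
·½^-≤ a m k {ε} 0<ε 1≤mε ma≤2^k = begin
  a · p                    ≡⟨ ℚ.*-identityʳ (a · p) ⟨
  a · p ℚ.* 1ℚ             ≤⟨ ℚ.*-monoˡ-≤-nonNeg (a · p) {{ℚ.nonNegative (·-nonNeg a (0≤½^ k))}} 1≤mε ⟩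
  a · p ℚ.* (m · ε)        ≡⟨ ×-comm-* m (a · p) ε ⟩
  m · (a · p ℚ.* ε)        ≡⟨ ×-assoc-* m (a · p) ε ⟨
  m · (a · p) ℚ.* ε        ≡⟨ cong (ℚ._* ε) (×-assocˡ p m a) ⟩
  (m * a) · p ℚ.* ε        ≤⟨ ℚ.*-monoʳ-≤-nonNeg ε {{ℚ.nonNegative (ℚ.<⇒≤ 0<ε)}} (·-monoˡ-≤ (0≤½^ k) ma≤2^k) ⟩
  (2 ^ k) · p ℚ.* ε        ≡⟨ cong (ℚ._* ε) (2^k·½^k≡1 k) ⟩
  1ℚ ℚ.* ε                 ≡⟨ ℚ.*-identityˡ ε ⟩
  ε                        ∎
  where
  open ℚ.≤-Reasoning
  p = ½ ^ℚ k

-- Bernoulli's inequality for `(1 + 1/a) ^ m`, cleared of denominators.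
bernoulli : ∀ a m → a ^ m * (a + m) ≤ a * suc a ^ m
bernoulli a zero    = ≤-reflexive (identity a)
  where
  identity : ∀ a → 1 * (a + 0) ≡ a * 1
  identity = solve-∀
bernoulli a (suc m) = begin
  a * a ^ m * (a + suc m)               ≡⟨ identity₁ a (a ^ m) m ⟩
  a * (a ^ m * (a + m)) + a * a ^ m     ≤⟨ +-mono-≤ (*-monoʳ-≤ a (bernoulli a m)) (*-monoʳ-≤ a (^-monoˡ-≤ m (n≤1+n a))) ⟩
  a * (a * suc a ^ m) + a * suc a ^ m   ≡⟨ identity₂ a (suc a ^ m) ⟩
  a * (suc a * suc a ^ m)               ∎
  where
  open ≤-Reasoning
  identity₁ : ∀ a p m → a * p * (a + suc m) ≡ a * (p * (a + m)) + a * p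
  identity₁ = solve-∀
  identity₂ : ∀ a p → a * (a * p) + a * p ≡ a * (suc a * p)
  identity₂ = solve-∀

exponential-gap : ∀ a m → ∃ λ t → m * a ^ t ≤ suc a ^ t
-- Exponent `m * a` in Bernoulli supplies the factor `m * a`; the one further round absorbs the
-- remaining `a`.
exponential-gap a m = suc (m * a) , (begin
  m * (a * a ^ (m * a))          ≡⟨ identity m a (a ^ (m * a)) ⟩
  a ^ (m * a) * (m * a)          ≤⟨ *-monoʳ-≤ (a ^ (m * a)) (m≤n+m (m * a) a) ⟩
  a ^ (m * a) * (a + m * a)      ≤⟨ bernoulli a (m * a) ⟩
  a * suc a ^ (m * a)            ≤⟨ *-monoˡ-≤ (suc a ^ (m * a)) (n≤1+n a) ⟩
  suc a * suc a ^ (m * a)        ∎)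
  where
  open ≤-Reasoning
  identity : ∀ m a p → m * (a * p) ≡ p * (m * a)
  identity = solve-∀

-- Listing all words except one constant word.

length-cartesianProductWith : ∀ {A B C : Set} (f : A → B → C) xs ys →
  length (cartesianProductWith f xs ys) ≡ length xs * length ys
length-cartesianProductWith f []       ys = refl
length-cartesianProductWith f (x ∷ xs) ys = trans (length-++ (map (f x) ys))
  (cong₂ _+_ (length-map (f x) ys) (length-cartesianProductWith f xs ys))

-- The relation is a parameter because words are functions, compared pointwise without function
-- extensionality.
Others : {A : Set} → Rel A 0ℓ → A → List A → Set
Others _≈_ x xs = ∀ y → (y ≈ x) ⊎ Any (y ≈_) xs

Pointwise : {A : Set} {k : ℕ} → Rel A 0ℓ → Rel (Fin k → A) 0ℓ
Pointwise _≈_ f g = ∀ i → f i ≈ g i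

-- The words that are not constantly `x`: a first letter `x` needs such a tail, a letter of `xs`
-- takes any tail. It is applied twice, to the coins of one round and to the rounds of a block.
nonConstant : {A : Set} → A → List A → ∀ k → List (Fin k → A)
nonConstant x xs zero    = []
nonConstant x xs (suc k) = map (x Vector.∷_) (nonConstant x xs k)
  ++ cartesianProductWith Vector._∷_ xs (const x ∷ nonConstant x xs k)

-- Counting the omitted constant word as well makes the recursion multiplicative.
length-nonConstant : ∀ {A : Set} (x : A) xs k → suc (length (nonConstant x xs k)) ≡ suc (length xs) ^ k
length-nonConstant x xs zero    = refl
length-nonConstant x xs (suc k) = begin
  suc (length (map (x Vector.∷_) ws ++ cartesianProductWith Vector._∷_ xs (const x ∷ ws)))
    ≡⟨ cong suc (length-++ (map (x Vector.∷_) ws)) ⟩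
  suc (length (map (x Vector.∷_) ws) + length (cartesianProductWith Vector._∷_ xs (const x ∷ ws)))
    ≡⟨ cong₂ (λ a b → suc (a + b)) (length-map _ ws) (length-cartesianProductWith Vector._∷_ xs _) ⟩
  suc (length xs) * suc (length ws)
    ≡⟨ cong (suc (length xs) *_) (length-nonConstant x xs k) ⟩
  suc (length xs) * suc (length xs) ^ k ∎
  where
  open ≡-Reasoning
  ws = nonConstant x xs k

∷-pointwise : ∀ {A : Set} {_≈_ : Rel A 0ℓ} {k} {y : Fin (suc k) → A} {x} {w : Fin k → A} →
  y zero ≈ x → Pointwise _≈_ (y ∘ suc) w → Pointwise _≈_ y (x Vector.∷ w)
∷-pointwise p q zero    = p
∷-pointwise p q (suc i) = q i

nonConstant-others : ∀ {A : Set} {_≈_ : Rel A 0ℓ} {x xs} → Others _≈_ x xs →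
  ∀ k → Others (Pointwise _≈_) (const x) (nonConstant x xs k)
nonConstant-others others zero    y = inj₁ λ ()
nonConstant-others {_≈_ = _≈_} {x} {xs} others (suc k) y with others (y zero) | nonConstant-others others k (y ∘ suc)
... | inj₁ p | inj₁ q = inj₁ λ { zero → p ; (suc i) → q i }
... | inj₁ p | inj₂ q = inj₂ (++⁺ˡ (map⁺ (Any.map (λ {w} → ∷-pointwise {_≈_ = _≈_} {y = y} {w = w} p) q)))
... | inj₂ p | q = inj₂ (++⁺ʳ (map (x Vector.∷_) (nonConstant x xs k))
  (cartesianProductWith⁺ Vector._∷_ {P = y zero ≈_} {Q = Pointwise _≈_ (y ∘ suc)}
    (λ {_} {w} → ∷-pointwise {_≈_ = _≈_} {y = y} {w = w}) p ([ here , there ]′ q)))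

others-white : Others _≡_ white (blue ∷ [])
others-white blue  = inj₂ (here refl)
others-white white = inj₁ refl

nth : {A : Set} → List A → ℕ → Maybe A
nth []       _       = nothing
nth (x ∷ xs) zero    = just x
nth (x ∷ xs) (suc m) = nth xs m

-- Cylinders, and the almost sure occurrence of a white block.

module _ {n : ℕ} where

  Block : ℕ → Set
  Block k = Fin k → Fin n → Color

  Starts : ∀ {k} → Ω n → Block k → Set
  Starts ω w = ∀ s i → ω (toℕ s) i ≡ w s i

  -- A finite list as a countable cover: past its end every member is empty and has measure 0.
  cylinders : ∀ {k} → List (Block k) → ℕ → Maybe (Cylinder n)
  cylinders ws l = Maybe.map (_ ,_) (nth ws l)

  ∈-cylinders : ∀ {k ω} {ws : List (Block k)} → Any (Starts ω) ws → ∃ λ l → ω ∈ᶜ cylinders ws l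
  ∈-cylinders (here p)  = 0 , p
  ∈-cylinders (there p) = let l , q = ∈-cylinders p in suc l , q

  sum-cylinders : ∀ {k} (ws : List (Block k)) m →
    sum {m} (λ l → μ (cylinders ws (toℕ l))) ℚ.≤ length ws · (½ ^ℚ (k * n))
  sum-cylinders {k} ws       zero    = ·-nonNeg (length ws) (0≤½^ (k * n))
  sum-cylinders {k} []       (suc m) = subst (ℚ._≤ 0ℚ) (sym (ℚ.+-identityˡ _)) (sum-cylinders {k} [] m)
  sum-cylinders {k} (w ∷ ws) (suc m) = ℚ.+-monoʳ-≤ (½ ^ℚ (k * n)) (sum-cylinders ws m)

  concatenations : ∀ {k} → List (Block k) → ∀ m → List (Block (m * k))
  concatenations ws zero    = (λ ()) ∷ []
  concatenations ws (suc m) = cartesianProductWith Vector._++_ ws (concatenations ws m)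

  length-concatenations : ∀ {k} (ws : List (Block k)) m → length (concatenations ws m) ≡ length ws ^ m
  length-concatenations ws zero    = refl
  length-concatenations ws (suc m) = trans (length-cartesianProductWith Vector._++_ ws _)
    (cong (length ws *_) (length-concatenations ws m))

  starts-++ : ∀ {j k} {ω : Ω n} {v : Block j} {w : Block k} →
    Starts ω v → Starts (ω ∘ (_+_ j)) w → Starts ω (v Vector.++ w)
  starts-++ {j} {k} {ω} {v} {w} p q s i with splitAt j s | join-splitAt j k s
  ... | inj₁ t | refl = trans (cong (λ r → ω r i) (toℕ-↑ˡ t k)) (p t i)
  ... | inj₂ t | refl = trans (cong (λ r → ω r i) (toℕ-↑ʳ j t)) (q t i)

  -- Dropping the first `k` rounds turns block `suc l` into block `l`.
  starts-concatenations : ∀ {k} {ws : List (Block k)} m {ω : Ω n} →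
    (∀ l → Any (Starts (ω ∘ (_+_ (l * k)))) ws) → Any (Starts ω) (concatenations ws m)
  starts-concatenations zero            h = here λ ()
  starts-concatenations {k} (suc m) {ω} h =
    cartesianProductWith⁺ Vector._++_ (λ {v} {w} → starts-++ {ω = ω} {v} {w}) (h 0)
      (starts-concatenations m {ω ∘ (_+_ k)} λ l → Any.map
        (λ {w} p s i → trans (cong (λ r → ω r i) (sym (+-assoc k (l * k) (toℕ s)))) (p s i)) (h (suc l)))

  -- The offset `s` comes first in the sum so that `RMM` unfolds along the block.
  WhiteBlock : ℕ → Ω n → ℕ → Set
  WhiteBlock k ω l = ∀ s → s < k → ∀ i → ω (s + l * k) i ≡ white

  white-block : ∀ k → AlmostSurely {n} (λ ω → ∃ (WhiteBlock k ω))
  white-block k ε 0<ε = cylinders words , covers , small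
    where
    nonWhite : List (Block k)
    nonWhite = nonConstant (const white) (nonConstant white (blue ∷ []) n) k

    size = length nonWhite

    1+size : suc size ≡ 2 ^ (n * k)
    1+size = begin
      suc size                                                      ≡⟨ length-nonConstant (const white) _ k ⟩
      suc (length (nonConstant white (blue ∷ []) n)) ^ k            ≡⟨ cong (_^ k) (length-nonConstant white (blue ∷ []) n) ⟩
      (2 ^ n) ^ k                                                   ≡⟨ ^-*-assoc 2 n k ⟩
      2 ^ (n * k)                                                   ∎
      where open ≡-Reasoning

    other : Others (Pointwise (Pointwise _≡_)) (λ _ _ → white) nonWhite
    other = nonConstant-others (nonConstant-others others-white n) k

    -- As `1ℚ ≤ q · ε`, total measure `1 / q` is small enough; `t` is chosen so that
    -- `(size / suc size) ^ t` is at most that.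
    open Σ (archimedean ε 0<ε) renaming (proj₁ to q; proj₂ to 1≤qε)
    open Σ (exponential-gap size q) renaming (proj₁ to t; proj₂ to gap)

    words : List (Block (t * k))
    words = concatenations nonWhite t

    covers : ∀ ω → ¬ ∃ (WhiteBlock k ω) → ∃ λ m → ω ∈ᶜ cylinders words m
    covers ω h = ∈-cylinders (starts-concatenations t {ω} not-white)
      where
      not-white : ∀ l → Any (Starts (ω ∘ (_+_ (l * k)))) nonWhite
      not-white l with other (λ s → ω (l * k + toℕ s))
      ... | inj₂ p = p
      ... | inj₁ p = contradiction (l , λ s s<k i → trans
        (cong (λ r → ω r i) (trans (+-comm s (l * k)) (cong (_+_ (l * k)) (sym (toℕ-fromℕ< s<k)))))
        (p (fromℕ< s<k) i)) h

    small : ∀ m → sum {m} (λ l → μ (cylinders words (toℕ l))) ℚ.≤ ε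
    small m = ℚ.≤-trans (sum-cylinders words m) (·½^-≤ (length words) q (t * k * n) 0<ε 1≤qε (begin
      q * length words        ≡⟨ cong (q *_) (length-concatenations nonWhite t) ⟩
      q * size ^ t            ≤⟨ gap ⟩
      suc size ^ t            ≡⟨ cong (_^ t) 1+size ⟩
      (2 ^ (n * k)) ^ t       ≡⟨ ^-*-assoc 2 (n * k) t ⟩
      2 ^ (n * k * t)         ≡⟨ cong (2 ^_) (identity n k t) ⟩
      2 ^ (t * k * n)         ∎))
      where
      open ≤-Reasoning
      identity : ∀ n k t → n * k * t ≡ t * k * n
      identity = solve-∀

-- Dynamics on the cycle

+-suc-suc : ∀ m k → m + (2 + k) ≡ 2 + (m + k)
+-suc-suc m k = trans (+-suc m (suc k)) (cong suc (+-suc m k))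

-- The rule at a node of degree two; the third argument is the tie color.
majority : Color → Color → Color → Color
majority blue  blue  _ = blue
majority white white _ = white
majority blue  white t = t
majority white blue  t = t

opposite-unique : ∀ {x y z : Color} → x ≢ y → y ≢ z → x ≡ z
opposite-unique {blue}  {blue}          p _ = contradiction refl p
opposite-unique {blue}  {white} {blue}  _ _ = refl
opposite-unique {blue}  {white} {white} _ q = contradiction refl q
opposite-unique {white} {blue}  {blue}  _ q = contradiction refl q
opposite-unique {white} {blue}  {white} _ _ = refl
opposite-unique {white} {white}         p _ = contradiction refl p

blue-ext : ∀ {x y} → (x ≡ blue → y ≡ blue) → (y ≡ blue → x ≡ blue) → x ≡ y
blue-ext {blue}          p _ = sym (p refl)
blue-ext {white} {blue}  _ q = q refl
blue-ext {white} {white} _ _ = refl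

majority-same : ∀ x t → majority x x t ≡ x
majority-same blue  _ = refl
majority-same white _ = refl

majority-keepsˡ : ∀ x y → majority x y x ≡ x
majority-keepsˡ blue  blue  = refl
majority-keepsˡ blue  white = refl
majority-keepsˡ white blue  = refl
majority-keepsˡ white white = refl

majority-keepsʳ : ∀ x y → majority x y y ≡ y
majority-keepsʳ blue  blue  = refl
majority-keepsʳ blue  white = refl
majority-keepsʳ white blue  = refl
majority-keepsʳ white white = refl

majority-white-blue : ∀ {x y} → majority x y white ≡ blue → x ≡ blue × y ≡ blue
majority-white-blue {blue}  {blue}  _ = refl , refl
majority-white-blue {blue}  {white} ()
majority-white-blue {white} {blue}  ()
majority-white-blue {white} {white} ()

module _ (n : ℕ) (n≥3 : 3 ≤ n) where

  private
    G = cycle n n≥3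

    instance
      n≢0 : NonZero n
      n≢0 = >-nonZero (≤-trans (s≤s z≤n) n≥3)

  -- Indices modulo `n` and the two neighbours of a node.

  next-unique : ∀ {i j k : Fin n} → Next i j → Next i k → j ≡ k
  next-unique (inj₁ p)       (inj₁ q)       = toℕ-injective (trans (sym p) q)
  next-unique {j = j} (inj₁ p) (inj₂ (q , _)) = contradiction (trans (sym p) q) (<⇒≢ (toℕ<n j))
  next-unique {k = k} (inj₂ (p , _)) (inj₁ q) = contradiction (trans (sym q) p) (<⇒≢ (toℕ<n k))
  next-unique (inj₂ (_ , p)) (inj₂ (_ , q)) = toℕ-injective (trans p (sym q))

  previous-unique : ∀ {i j k : Fin n} → Next i k → Next j k → i ≡ j
  previous-unique (inj₁ p)       (inj₁ q)       = toℕ-injective (suc-injective (trans p (sym q)))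
  previous-unique (inj₁ p)       (inj₂ (_ , q)) = contradiction (trans p q) 1+n≢0
  previous-unique (inj₂ (_ , p)) (inj₁ q)       = contradiction (trans q p) 1+n≢0
  previous-unique (inj₂ (p , _)) (inj₂ (q , _)) = toℕ-injective (suc-injective (trans p (sym q)))

  -- Returning after two steps would force `n` below 3. So the two neighbours are distinct, as
  -- `neighbours-↭` requires.
  previous≢next : ∀ {i j k : Fin n} → Next i j → Next j k → i ≢ k
  previous≢next {i} {j} p q refl = absurd n≥3 p q
    where
    absurd : ∀ {a b n} → 3 ≤ n → (suc a ≡ b) ⊎ (suc a ≡ n × b ≡ 0) → (suc b ≡ a) ⊎ (suc b ≡ n × a ≡ 0) → ⊥
    absurd _ (inj₁ refl) (inj₁ q) = m+1+n≢m _ (trans (+-comm _ 2) q)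
    absurd (s≤s (s≤s ())) (inj₁ refl) (inj₂ (refl , refl))
    absurd (s≤s (s≤s ())) (inj₂ (refl , refl)) (inj₁ refl)

  -- Indexing by all naturals lets inductions run around the cycle without wrap-around cases.
  node : ℕ → Fin n
  node k = k mod n

  toℕ-node : ∀ k → toℕ (node k) ≡ k % n
  toℕ-node k = toℕ-fromℕ< (m%n<n k n)

  node-toℕ : ∀ i → node (toℕ i) ≡ i
  node-toℕ i = toℕ-injective (trans (toℕ-node (toℕ i)) (m<n⇒m%n≡m (toℕ<n i)))

  node-shift : ∀ m {k} → n ∣ m → node (m + k) ≡ node k
  node-shift m {k} n∣m = toℕ-injective (trans (toℕ-node (m + k)) (trans (%-remove-+ˡ k n∣m) (sym (toℕ-node k))))

  suc-% : ∀ k → suc k % n ≡ suc (k % n) % n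
  suc-% k = trans (%-distribˡ-+ 1 k n)
    (cong (λ r → (r + k % n) % n) (m<n⇒m%n≡m (≤-trans (s≤s (s≤s z≤n)) n≥3)))

  next-node : ∀ k → Next (node k) (node (suc k))
  next-node k rewrite toℕ-node k | toℕ-node (suc k) | suc-% k with m≤n⇒m<n∨m≡n (m%n<n k n)
  ... | inj₁ lt = inj₁ (sym (m<n⇒m%n≡m lt))
  ... | inj₂ eq = inj₂ (eq , trans (cong (_% n) eq) (n%n≡0 n))

  next-suc : ∀ i → Next i (node (suc (toℕ i)))
  next-suc i = subst (λ j → Next j (node (suc (toℕ i)))) (node-toℕ i) (next-node (toℕ i))

  next-previous : ∀ i → ∃ λ h → Next h i
  -- Modulo `n`, `pred n` steps forward are one step back.
  next-previous i = node (pred n + toℕ i) , subst (Next _) eq (next-node (pred n + toℕ i))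
    where
    eq : node (suc (pred n) + toℕ i) ≡ i
    eq = trans (cong (λ m → node (m + toℕ i)) (suc-pred n)) (trans (node-shift n ∣-refl) (node-toℕ i))

  -- The filtered list has an order depending on the wrap-around, but both lists are duplicate-free
  -- with the same members, and counting ignores order.
  neighbours-↭ : ∀ {h i j} → Next h i → Next i j → neighbours G i ↭ h ∷ j ∷ []
  neighbours-↭ {h} {i} {j} p q = ∼bag⇒↭ (unique∧set⇒bag
    (filter⁺ (Graph.adj? G i) (allFin⁺ n))
    ((previous≢next p q ∷ []) ∷ [] ∷ [])
    (mk⇔ (to ∘ proj₂ ∘ ∈-filter⁻ (Graph.adj? G i) {xs = allFin n}) (∈-filter⁺ (Graph.adj? G i) (∈-allFin _) ∘ from)))
    where
    to : ∀ {k} → Adj G i k → k ∈ h ∷ j ∷ []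
    to (inj₁ r) = there (here (next-unique r q))
    to (inj₂ r) = here (previous-unique r p)
    from : ∀ {k} → k ∈ h ∷ j ∷ [] → Adj G i k
    from (here refl)         = inj₂ p
    from (there (here refl)) = inj₁ q

  update-majority : ∀ tie c {h i j} → Next h i → Next i j → update G tie c i ≡ majority (c h) (c j) (tie i)
  update-majority tie c {h} {i} {j} p q
    rewrite ↭-length (filter-↭ (λ k → c k ≟ᶜ white) (neighbours-↭ p q))
          | ↭-length (filter-↭ (λ k → c k ≟ᶜ blue) (neighbours-↭ p q))
    with c h | c j in eqⱼ
  ... | blue  | blue  rewrite eqⱼ = refl
  ... | blue  | white rewrite eqⱼ = refl
  ... | white | blue  rewrite eqⱼ = refl
  ... | white | white rewrite eqⱼ = refl

  alternating : ∀ {c} → (∀ k → c (node k) ≢ c (node (suc k))) → Alternating G c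
  alternating {c} h i j (inj₁ p) rewrite next-unique p (next-suc i) =
    subst (λ k → c k ≢ c (node (suc (toℕ i)))) (node-toℕ i) (h (toℕ i))
  alternating h i j (inj₂ p) = alternating h j i (inj₁ p) ∘ sym

  -- Two color changes cancel, so even indices share the color of node 0. For odd `n` the even index
  -- `n / 2 * 2` is `n - 1`, whose successor is node 0.
  odd⇒¬alternating : 2 ∤ n → ∀ {c} → ¬ Alternating G c
  odd⇒¬alternating 2∤n {c} alt = alt _ _ (inj₁ (next-node (n / 2 * 2))) (begin
    c (node (n / 2 * 2))         ≡⟨ even (n / 2) ⟩
    c (node 0)                   ≡⟨ cong c (node-shift n ∣-refl) ⟨
    c (node (n + 0))             ≡⟨ cong (c ∘ node) (+-identityʳ n) ⟩
    c (node n)                   ≡⟨ cong (c ∘ node) odd ⟩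
    c (node (suc (n / 2 * 2)))   ∎)
    where
    open ≡-Reasoning
    even : ∀ m → c (node (m * 2)) ≡ c (node 0)
    even zero    = refl
    even (suc m) = trans (sym (opposite-unique (alt _ _ (inj₁ (next-node (m * 2)))) (alt _ _ (inj₁ (next-node (suc (m * 2))))))) (even m)
    n%2≡1 : ∀ r → r < 2 → n % 2 ≡ r → n % 2 ≡ 1
    n%2≡1 0 _ eq = contradiction (m%n≡0⇒n∣m n 2 eq) 2∤n
    n%2≡1 1 _ eq = eq
    n%2≡1 (suc (suc _)) (s≤s (s≤s ())) _
    odd : n ≡ suc (n / 2 * 2)
    odd = trans (m≡m%n+[m/n]*n n 2) (cong (_+ n / 2 * 2) (n%2≡1 _ (m%n<n n 2) refl))

  -- Locked nodes in the Majority Model.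

  Locked : Coloring n → Fin n → Set
  Locked c i = ∃ λ j → Adj G i j × c i ≡ c j

  locked-keeps : ∀ {c i} → Locked c i → mmStep G c i ≡ c i
  locked-keeps {c} {i} (j , inj₁ p , eq) = trans (update-majority c c (proj₂ (next-previous i)) p)
    (trans (cong (λ x → majority (c (proj₁ (next-previous i))) x (c i)) (sym eq)) (majority-keepsʳ _ (c i)))
  locked-keeps {c} {i} (j , inj₂ p , eq) = trans (update-majority c c p (next-suc i))
    (trans (cong (λ x → majority x (c (node (suc (toℕ i)))) (c i)) (sym eq)) (majority-keepsˡ (c i) _))

  -- The edge locks both of its ends, so both keep their common color.
  locked-persists : ∀ {c i} → Locked c i → Locked (mmStep G c) i
  locked-persists {c} {i} l@(j , adj , eq) = j , adj ,
    trans (locked-keeps l) (trans eq (sym (locked-keeps (i , Graph.symm G adj , sym eq))))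

  -- If `j` agrees with a neighbour, it is locked already. Otherwise both its neighbours have the
  -- color of `i`, so `j` takes that color while `i` keeps it.
  locked-spreads : ∀ {c i j} → Next i j → Locked c i → Locked (mmStep G c) j
  locked-spreads {c} {i} {j} p l with c j ≟ᶜ c i | c j ≟ᶜ c (node (suc (toℕ j)))
  ... | yes eq | _      = locked-persists (i , inj₂ p , eq)
  ... | no _   | yes eq = locked-persists (_ , inj₁ (next-suc j) , eq)
  ... | no j≢i | no j≢k = i , inj₂ p , (begin
    mmStep G c j                      ≡⟨ update-majority c c p (next-suc j) ⟩
    majority (c i) (c _) (c j)        ≡⟨ cong (λ x → majority (c i) x (c j)) (opposite-unique (j≢i ∘ sym) j≢k) ⟨
    majority (c i) (c i) (c j)        ≡⟨ majority-same (c i) (c j) ⟩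
    c i                               ≡⟨ locked-keeps l ⟨
    mmStep G c i                      ∎)
    where open ≡-Reasoning

  locked-MM : ∀ {c k} → Locked c (node k) → ∀ {m t} → m ≤ t → Locked (MM G c t) (node (m + k))
  locked-MM l {t = zero}  z≤n       = l
  locked-MM l {t = suc t} z≤n       = locked-persists (locked-MM l {t = t} z≤n)
  locked-MM l {m = suc m} (s≤s m≤t) = locked-spreads (next-node (m + _)) (locked-MM l m≤t)

  locked⇒stable : ∀ {c k} → Locked c (node k) → Reaches (MM G c) (MMStable G)
  -- Walking `toℕ i + pred n * k` steps from `k` ends at `toℕ i + n * k`, which is `i` modulo `n`;
  -- the time bounds this for all `i`.
  locked⇒stable {c} {k} l = n + pred n * k , λ i → locked-keeps (subst (Locked _) (position i)
    (locked-MM l (+-monoˡ-≤ (pred n * k) (<⇒≤ (toℕ<n i)))))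
    where
    open ≡-Reasoning
    position : ∀ i → node (toℕ i + pred n * k + k) ≡ i
    position i = begin
      node (toℕ i + pred n * k + k)    ≡⟨ cong node (trans (+-assoc (toℕ i) _ k) (+-comm (toℕ i) _)) ⟩
      node (pred n * k + k + toℕ i)    ≡⟨ cong (λ m → node (m + toℕ i)) (+-comm _ k) ⟩
      node (suc (pred n) * k + toℕ i)  ≡⟨ cong (λ m → node (m * k + toℕ i)) (suc-pred n) ⟩
      node (n * k + toℕ i)             ≡⟨ node-shift (n * k) (m∣m*n k) ⟩
      node (toℕ i)                     ≡⟨ node-toℕ i ⟩
      i                                ∎

  MM-stable⊎alternating : ∀ c → Reaches (MM G c) (MMStable G) ⊎ Alternating G c
  MM-stable⊎alternating c with any? (λ i → c i ≟ᶜ c (node (suc (toℕ i))))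
  ... | yes (i , eq) = inj₁ (locked⇒stable (subst (Locked c) (sym (node-toℕ i)) (_ , inj₁ (next-suc i) , eq)))
  ... | no none      = inj₂ (alternating λ k eq → none (node k ,
    trans eq (cong c (next-unique (next-node k) (next-suc (node k))))))

  -- White rounds in the Random Majority Model.

  -- Blue exactly when c is blue on k, k + 2, …, k + 2 t: the color of node k + t after t rounds
  -- in which every tie is broken to white.
  conjunction : Coloring n → ℕ → ℕ → Color
  conjunction c zero    k = c (node k)
  conjunction c (suc t) k = majority (conjunction c t k) (conjunction c t (2 + k)) white

  conjunction-blue⁻ : ∀ c t {k} → conjunction c t k ≡ blue → ∀ {l} → l ≤ t → c (node (l * 2 + k)) ≡ blue
  conjunction-blue⁻ c zero    eq z≤n = eq
  conjunction-blue⁻ c (suc t) eq z≤n = conjunction-blue⁻ c t (proj₁ (majority-white-blue eq)) z≤n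
  conjunction-blue⁻ c (suc t) {k} eq {suc l} (s≤s l≤t) = trans
    (cong (c ∘ node) (sym (+-suc-suc (l * 2) k)))
    (conjunction-blue⁻ c t (proj₂ (majority-white-blue {x = conjunction c t k} eq)) l≤t)

  conjunction-blue⁺ : ∀ c t {k} → (∀ {l} → l ≤ t → c (node (l * 2 + k)) ≡ blue) → conjunction c t k ≡ blue
  conjunction-blue⁺ c zero        h = h z≤n
  conjunction-blue⁺ c (suc t) {k} h = cong₂ (λ x y → majority x y white)
    (conjunction-blue⁺ c t (h ∘ m≤n⇒m≤1+n))
    (conjunction-blue⁺ c t λ {l} l≤t → trans
      (cong (c ∘ node) (+-suc-suc (l * 2) k)) (h (s≤s l≤t)))

  -- The shift trades the entry `l = 0` for `l = n + 1`. Modulo `n` these repeat the entries `l = n`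
  -- and `l = 1`, which both windows contain.
  conjunction-periodic : ∀ c k → conjunction c n k ≡ conjunction c n (2 + k)
  conjunction-periodic c k = blue-ext
    (λ eq → conjunction-blue⁺ c n (forward (conjunction-blue⁻ c n eq)))
    (λ eq → conjunction-blue⁺ c n (backward (conjunction-blue⁻ c n eq)))
    where
    forward : (∀ {l} → l ≤ n → c (node (l * 2 + k)) ≡ blue) → ∀ {l} → l ≤ n → c (node (l * 2 + (2 + k))) ≡ blue
    forward h {l} l≤n with m≤n⇒m<n∨m≡n l≤n
    ... | inj₁ l<n  = trans (cong (c ∘ node) (+-suc-suc (l * 2) k)) (h l<n)
    ... | inj₂ refl = trans (cong c (node-shift (n * 2) (m∣m*n 2))) (h (≤-trans (s≤s z≤n) n≥3))
    backward : (∀ {l} → l ≤ n → c (node (l * 2 + (2 + k))) ≡ blue) → ∀ {l} → l ≤ n → c (node (l * 2 + k)) ≡ blue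
    backward h {suc l} l<n = trans (cong (c ∘ node) (sym (+-suc-suc (l * 2) k))) (h (<⇒≤ l<n))
    backward h {zero}  _   = begin
      c (node k)                          ≡⟨ cong c (node-shift (n * 2) (m∣m*n 2)) ⟨
      c (node (n * 2 + k))                ≡⟨ cong (λ m → c (node (m * 2 + k))) (suc-pred n) ⟨
      c (node (suc (pred n) * 2 + k))     ≡⟨ cong (c ∘ node) (+-suc-suc (pred n * 2) k) ⟨
      c (node (pred n * 2 + (2 + k)))     ≡⟨ h pred[n]≤n ⟩
      blue                                ∎
      where open ≡-Reasoning

  -- The index advances with the time, so the neighbours of `node (suc t + k)` are `node (t + k)`
  -- and `node (t + (2 + k))`, to which the induction hypothesis applies.
  RMM-conjunction : ∀ {c ω a} t → (∀ s → s < t → ∀ i → ω (s + a) i ≡ white) →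
    ∀ k → RMM G c ω (t + a) (node (t + k)) ≡ conjunction (RMM G c ω a) t k
  RMM-conjunction zero    h k = refl
  RMM-conjunction {c} {ω} {a} (suc t) h k = begin
    RMM G c ω (suc t + a) (node (suc t + k))  ≡⟨ update-majority (ω (t + a)) X (next-node (t + k)) (next-node (suc t + k)) ⟩
    majority (X (node (t + k))) (X (node (2 + (t + k)))) (ω (t + a) (node (suc t + k)))
      ≡⟨ cong₂ (λ m w → majority (X (node (t + k))) (X (node m)) w) (sym (+-suc-suc t k)) (h t ≤-refl _) ⟩
    majority (X (node (t + k))) (X (node (t + (2 + k)))) white
      ≡⟨ cong₂ (λ x y → majority x y white) (previous k) (previous (2 + k)) ⟩
    conjunction (RMM G c ω a) (suc t) k ∎
    where
    open ≡-Reasoning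
    X = RMM G c ω (t + a)
    previous = RMM-conjunction {c} {ω} {a} t (λ s s<t → h s (m≤n⇒m≤1+n s<t))

  -- Comparing nodes 0 and 1 decides: period 2 carries their equality or difference to every
  -- adjacent pair.
  2-periodic : ∀ {c} → (∀ k → c (node k) ≡ c (node (2 + k))) → AllWhite c ⊎ AllBlue c ⊎ Alternating G c
  2-periodic {c} h with c (node 0) ≟ᶜ c (node 1)
  ... | no 0≢1 = inj₂ (inj₂ (alternating alternates))
    where
    alternates : ∀ k → c (node k) ≢ c (node (suc k))
    alternates zero    eq = 0≢1 eq
    alternates (suc k) eq = alternates k (trans (h k) (sym eq))
  ... | yes 0≡1 = split (c (node 0)) refl
    where
    constant : ∀ k → c (node k) ≡ c (node 0)
    constant zero          = refl
    constant (suc zero)    = sym 0≡1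
    constant (suc (suc k)) = trans (sym (h k)) (constant k)
    all : ∀ i → c i ≡ c (node 0)
    all i = trans (cong c (sym (node-toℕ i))) (constant (toℕ i))
    split : ∀ x → c (node 0) ≡ x → AllWhite c ⊎ AllBlue c ⊎ Alternating G c
    split white eq = inj₁ λ i → trans (all i) eq
    split blue  eq = inj₂ (inj₁ λ i → trans (all i) eq)

  white-rounds : ∀ {c ω a} → (∀ s → s < n → ∀ i → ω (s + a) i ≡ white) →
    Reaches (RMM G c ω) (λ c → AllWhite c ⊎ AllBlue c ⊎ Alternating G c)
  white-rounds {c} {ω} {a} h = n + a , 2-periodic periodic
    where
    X = RMM G c ω (n + a)
    final : ∀ k → X (node k) ≡ conjunction (RMM G c ω a) n k
    -- After exactly `n` rounds the index has drifted by a full turn.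
    final k = trans (cong X (sym (node-shift n ∣-refl))) (RMM-conjunction n h k)
    periodic : ∀ k → X (node k) ≡ X (node (2 + k))
    periodic k = trans (final k) (trans (conjunction-periodic _ k) (sym (final (2 + k))))

-- Conclusion for both models and both parities.

-- The exceptional set of `Q` lies in that of `P`, so the same cover serves.
AlmostSurely-map : ∀ {n} {P Q : Ω n → Set} → (∀ {ω} → P ω → Q ω) → AlmostSurely P → AlmostSurely Q
AlmostSurely-map f null ε 0<ε =
  let C , covers , small = null ε 0<ε in C , (λ ω ¬q → covers ω (¬q ∘ f)) , small

theorem2p7 : (n : ℕ) (n≥3 : 3 ≤ n) (c₀ : Coloring n) → let G = cycle n n≥3 in
    (2 ∤ n → Reaches (MM G c₀) (MMStable G))
    × (2 ∣ n → Reaches (MM G c₀) (λ c → MMStable G c ⊎ Alternating G c))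
    × (2 ∤ n → AlmostSurely (λ ω → Reaches (RMM G c₀ ω) (λ c → AllWhite c ⊎ AllBlue c)))
    × (2 ∣ n → AlmostSurely (λ ω → Reaches (RMM G c₀ ω) (λ c → AllWhite c ⊎ AllBlue c ⊎ Alternating G c)))
theorem2p7 n n≥3 c₀ =
    (λ 2∤n → [ (λ r → r) , (λ alt → contradiction alt (odd⇒¬alternating n n≥3 2∤n)) ]′ (MM-stable⊎alternating n n≥3 c₀))
  , (λ _ → [ map₂ inj₁ , (λ alt → 0 , inj₂ alt) ]′ (MM-stable⊎alternating n n≥3 c₀))
  , (λ 2∤n → AlmostSurely-map (map₂ (monochromatic 2∤n)) reached)
  , (λ _ → reached)
  where
  G = cycle n n≥3

  monochromatic : 2 ∤ n → ∀ {c} → AllWhite c ⊎ AllBlue c ⊎ Alternating G c → AllWhite c ⊎ AllBlue c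
  monochromatic _   (inj₁ w)          = inj₁ w
  monochromatic _   (inj₂ (inj₁ b))   = inj₂ b
  monochromatic 2∤n (inj₂ (inj₂ alt)) = contradiction alt (odd⇒¬alternating n n≥3 2∤n)

  -- Shown for either parity; for odd `n`, `monochromatic` then rules out the alternating outcome.
  reached : AlmostSurely (λ ω → Reaches (RMM G c₀ ω) (λ c → AllWhite c ⊎ AllBlue c ⊎ Alternating G c))
  reached = AlmostSurely-map (λ (_ , h) → white-rounds n n≥3 h) (white-block n)
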